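{- Let $k\geq 3$, $g=2s+1\geq 7$, and $\epsilon$ be integers with $0<\epsilon\leq\frac{k-1}{2}$. Then there is no integer $n$ such that a $vgr(n,k,g,nc(k,g)-\epsilon)$-graph exists, where $nc(k,g)=\frac{k(k-1)^s}{2}$.
   Context: A $vgr(n,k,g,\lambda)$-graph is a $k$-regular graph of girth $g$ on $n$ vertices in which every vertex is contained in exactly $\lambda$ cycles of length $g$. -}

module Defs where

open import Data.Nat using (ℕ; zero; suc; _+_; _*_; _∸_; _^_; _≤_; _<_)
open import Data.Nat.DivMod using (_/_)
open import Data.Bool using (Bool; true; false; T)
open import Data.Fin using (Fin; zero; suc; toℕ; inject₁; fromℕ)
open import Data.Fin.Subset using (∣_∣)
open import Data.Vec using (Vec; lookup; tabulate)
open import Data.List using (List; length)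
open import Data.List.Membership.Propositional using (_∈_)
open import Data.List.Relation.Unary.Unique.Propositional using (Unique)
open import Data.Product using (Σ; _×_; ∃)
open import Data.Empty using (⊥)
open import Relation.Binary.PropositionalEquality using (_≡_)
open import Relation.Nullary using (¬_)

record Graph (n : ℕ) : Set where
  field
    adj    : Fin n → Fin n → Bool
    sym    : ∀ u v → adj u v ≡ adj v u
    irrefl : ∀ v → adj v v ≡ false

open Graph public

Adj : ∀ {n} → Graph n → Fin n → Fin n → Set
Adj G u v = T (adj G u v)

degree : ∀ {n} → Graph n → Fin n → ℕ
degree G v = ∣ tabulate (adj G v) ∣

Regular : ∀ {n} → ℕ → Graph n → Set
Regular k G = ∀ v → degree G v ≡ k

IsCycle : ∀ {n m} → Graph n → Vec (Fin n) m → Set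
IsCycle {m = zero} G c = ⊥
IsCycle {m = suc m} G c =
  (3 ≤ suc m)
  × (∀ i j → lookup c i ≡ lookup c j → i ≡ j)
  × (∀ (i : Fin m) → Adj G (lookup c (inject₁ i)) (lookup c (suc i)))
  × Adj G (lookup c (fromℕ m)) (lookup c zero)

HasCycleOfLength : ∀ {n} → Graph n → ℕ → Set
HasCycleOfLength {n} G m = Σ (Vec (Fin n) m) (IsCycle G)

Girth : ∀ {n} → Graph n → ℕ → Set
Girth G g = HasCycleOfLength G g × (∀ m → m < g → ¬ HasCycleOfLength G m)

-- Each cycle (as a subgraph) through v has exactly one canonical vertex
-- sequence: start at v, and the second vertex has smaller index than the last.
RootedCanonical : ∀ {n m} → Fin n → Vec (Fin n) m → Set
RootedCanonical {m = zero} v c = ⊥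
RootedCanonical {m = suc zero} v c = ⊥
RootedCanonical {m = suc (suc m)} v c =
  (lookup c zero ≡ v) × (toℕ (lookup c (suc zero)) < toℕ (lookup c (fromℕ (suc m))))

CyclesThrough : ∀ {n} → Graph n → ℕ → Fin n → ℕ → Set
CyclesThrough {n} G g v λ' =
  Σ (List (Vec (Fin n) g)) λ L →
    (length L ≡ λ') × Unique L
    × (∀ c → (IsCycle G c × RootedCanonical v c → c ∈ L)
           × (c ∈ L → IsCycle G c × RootedCanonical v c))

VGR : (n k g λ' : ℕ) → Graph n → Set
VGR n k g λ' G = Regular k G × Girth G g × (∀ v → CyclesThrough G g v λ')

-- nc(k,g) = k(k-1)^s/2 for g = 2s+1 (given in terms of s)
nc : ℕ → ℕ → ℕ
nc k s = (k * (k ∸ 1) ^ s) / 2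

{-# OPTIONS --safe #-}

-- Put q = k − 1 and let B(v) be the ball of radius s around v.  A non-backtracking
-- walk of length s + 1 from v that ends inside B(v) closes up, in exactly one way,
-- to an oriented girth cycle through v, so the k qˢ such walks split into 2λ closing
-- ones and 2ε ≤ q ones leaving B(v).  Hence at most q edges leave any ball, and balls
-- of adjacent vertices differ in at most q vertices.
-- If w lies just outside B(v), one of the k branches at w, say that of y, has all its
-- vertices at distance s from w outside B(v), for otherwise each branch would contain
-- its own edge leaving B(v).  Of the walks from w through y, all qˢ⁻¹ of length s and
-- all but q of the qˢ of length s + 1 then end outside B(v), and together with w their
-- ends give 1 + qˢ⁻¹ + qˢ − q vertices of B(y) ∖ B(v).  But y is at distance at most
-- s + 2 from v, so B(y) ∖ B(v) has at most (s + 2) q vertices, which is too few for s ≥ 3.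

module Submission where

open import Defs hiding (sym)
open import Data.Empty using (⊥; ⊥-elim)
open import Data.Bool using (true; false; T)
open import Data.Bool.Properties using (T?)
open import Data.Fin using (Fin; zero; suc; toℕ; inject₁; fromℕ; fromℕ<)
open import Data.Fin.Properties using (_≟_; any?; toℕ-injective)
open import Data.Fin.Subset using (∣_∣)
open import Data.List using (List; []; _∷_; [_]; _++_; _ʳ++_; length; map; filter; concatMap; reverse; take; drop; allFin)
import Data.List as List
open import Data.List.Properties
open import Data.List.Membership.Propositional using (_∈_; _∉_; find; lose)
open import Data.List.Membership.Propositional.Properties
open import Data.List.Relation.Unary.All as All using (All; []; _∷_)
open import Data.List.Relation.Unary.All.Properties using (¬Any⇒All¬; ¬All⇒Any¬; ++⁻ˡ)
open import Data.List.Relation.Unary.AllPairs using ([]; _∷_)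
open import Data.List.Relation.Unary.Any as Any using (Any; here; there)
open import Data.List.Relation.Unary.Unique.Propositional using (Unique)
import Data.List.Relation.Unary.Unique.Propositional.Properties as Unique
open import Data.Nat using (ℕ; zero; suc; _+_; _*_; _∸_; _^_; _≤_; _<_; z≤n; s≤s; _<?_; >-nonZero)
open import Data.Nat.Divisibility using (_∣_; divides; ∣m∣n⇒∣m+n; m∣m*n; ∣m⇒∣m*n)
open import Data.Nat.DivMod using (m/n*n≡m)
open import Data.Nat.Properties hiding (_≟_)
open import Data.Nat.Tactic.RingSolver using (solve-∀)
open import Data.Product using (Σ; ∃; _×_; _,_; proj₁; proj₂)
open import Data.Sum using (_⊎_; inj₁; inj₂)
open import Data.Vec as Vec using (Vec; []; _∷_; lookup; toList; fromList; tabulate)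
import Data.Vec.Properties as Vec
open import Function using (_∘_; id)
open import Relation.Binary.PropositionalEquality using (_≡_; _≢_; refl; sym; trans; cong; cong₂; subst; subst₂; module ≡-Reasoning)
open import Relation.Nullary using (¬_; Dec; yes; no; ¬?; _×-dec_; _⊎-dec_; contradiction)
open import Relation.Nullary.Decidable using (decidable-stable)
open import Relation.Unary using (Decidable)

-- Counting with duplicate-free lists

module _ {A B : Set} where

  -- Induction on `xs` deletes one occurrence of the head's partner from `ys`. No later entry needs
  -- that occurrence, since `inj` would identify it with the head. Having a relation in place of a
  -- function lets partners come straight from existence proofs.
  pigeonhole : (R : A → B → Set) {xs : List A} (ys : List B) → Unique xs →
    (∀ {x} → x ∈ xs → ∃ λ y → y ∈ ys × R x y) →
    (∀ {x x′ y} → R x y → R x′ y → x ≡ x′) → length xs ≤ length ys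
  pigeonhole R {[]} ys _ _ _ = z≤n
  pigeonhole R {x ∷ xs} ys (x∉xs ∷ xs!) total inj with total (here refl)
  ... | y , y∈ys , xRy with ∈-∃++ y∈ys
  ... | as , bs , refl = ≤-trans (s≤s (pigeonhole R (as ++ bs) xs! total′ inj))
          (≤-reflexive (sym (length-++-sucʳ as y bs)))
    where
    total′ : ∀ {x′} → x′ ∈ xs → ∃ λ y′ → y′ ∈ as ++ bs × R x′ y′
    total′ x′∈xs with total (there x′∈xs)
    ... | y′ , y′∈ , x′Ry′ with ∈-++⁻ as y′∈
    ... | inj₁ p = y′ , ∈-++⁺ˡ p , x′Ry′
    ... | inj₂ (there p) = y′ , ∈-++⁺ʳ as p , x′Ry′
    ... | inj₂ (here refl) = contradiction (inj xRy x′Ry′) (All.lookup x∉xs x′∈xs)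

  map-unique : (f : A → B) {xs : List A} → Unique xs →
    (∀ {x x′} → x ∈ xs → x′ ∈ xs → f x ≡ f x′ → x ≡ x′) → Unique (map f xs)
  map-unique f [] inj = []
  map-unique f (x∉xs ∷ xs!) inj =
    ¬Any⇒All¬ _ fx∉ ∷ map-unique f xs! (λ p q → inj (there p) (there q))
    where
    fx∉ : ¬ _
    fx∉ p with ∈-map⁻ f p
    ... | x′ , x′∈xs , eq = All.lookup x∉xs x′∈xs (inj (here refl) (there x′∈xs) eq)

  concatMap-unique : (f : A → List B) → (∀ x → Unique (f x)) →
    (∀ {x x′ y} → y ∈ f x → y ∈ f x′ → x ≡ x′) →
    ∀ {xs} → Unique xs → Unique (concatMap f xs)
  concatMap-unique f f! disj [] = []
  concatMap-unique f f! disj (x∉xs ∷ xs!) =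
    Unique.++⁺ (f! _) (concatMap-unique f f! disj xs!) λ (p , q) →
      let x′ , x′∈xs , y∈fx′ = find (∈-concatMap⁻ f q) in
      All.lookup x∉xs x′∈xs (disj p y∈fx′)

  length-concatMap-const : (f : A → List B) (q : ℕ) (xs : List A) →
    (∀ {x} → x ∈ xs → length (f x) ≡ q) → length (concatMap f xs) ≡ length xs * q
  length-concatMap-const f q [] eq = refl
  length-concatMap-const f q (x ∷ xs) eq =
    trans (length-++ (f x)) (cong₂ _+_ (eq (here refl)) (length-concatMap-const f q xs (eq ∘ there)))

module _ {A : Set} where

  filter-complement : {P : A → Set} (P? : Decidable P) (xs : List A) →
    length (filter P? xs) + length (filter (¬? ∘ P?) xs) ≡ length xs
  filter-complement P? [] = refl
  filter-complement P? (x ∷ xs) with P? x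
  ... | yes _ = cong suc (filter-complement P? xs)
  ... | no _ = trans (+-suc _ _) (cong suc (filter-complement P? xs))

  unique-++⁻ˡ : (xs : List A) {ys : List A} → Unique (xs ++ ys) → Unique xs
  unique-++⁻ˡ [] u = []
  unique-++⁻ˡ (x ∷ xs) (x∉ ∷ u) = ++⁻ˡ xs x∉ ∷ unique-++⁻ˡ xs u

  unique-++-disjoint : (xs : List A) {ys : List A} {z : A} → Unique (xs ++ ys) → z ∈ xs → z ∉ ys
  unique-++-disjoint (x ∷ xs) (x∉ ∷ u) (here refl) z∈ys = All.lookup x∉ (∈-++⁺ʳ xs z∈ys) refl
  unique-++-disjoint (x ∷ xs) (x∉ ∷ u) (there z∈xs) z∈ys = unique-++-disjoint xs u z∈xs z∈ys

  unique-ʳ++-disjoint : (xs : List A) {ys : List A} {z : A} → Unique (xs ʳ++ ys) → z ∈ xs → z ∉ ys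
  unique-ʳ++-disjoint xs u z∈xs =
    unique-++-disjoint (reverse xs) (subst Unique (ʳ++-defn xs) u) (reverse-∈ xs z∈xs)
    where
    reverse-∈ : ∀ xs {z} → z ∈ xs → z ∈ reverse xs
    reverse-∈ (x ∷ xs) p rewrite unfold-reverse x xs with p
    ... | here refl = ∈-++⁺ʳ (reverse xs) (here refl)
    ... | there q = ∈-++⁺ˡ (reverse-∈ xs q)

  -- With the starting point as default, `hd b p` is the end of the walk `p ++ [ b ]` even when `p`
  -- is empty.
  hd : A → List A → A
  hd d [] = d
  hd d (x ∷ _) = x

  hd-ʳ++ : ∀ {m} (d : A) (xs : Vec A (suc m)) (ys : List A) →
    hd d (toList xs ʳ++ ys) ≡ lookup xs (fromℕ m)
  hd-ʳ++ d (x ∷ []) ys = refl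
  hd-ʳ++ d (x ∷ y ∷ xs) ys = hd-ʳ++ d (y ∷ xs) (x ∷ ys)

  hd-++ : (d : A) (xs : List A) {b : A} {ys : List A} → hd d (xs ++ b ∷ ys) ≡ hd b xs
  hd-++ d [] = refl
  hd-++ d (x ∷ xs) = refl

  lookup-∈ : ∀ {m} (xs : Vec A m) i → lookup xs i ∈ toList xs
  lookup-∈ (x ∷ xs) zero = here refl
  lookup-∈ (x ∷ xs) (suc i) = there (lookup-∈ xs i)

  unique⇒lookup-injective : ∀ {m} (xs : Vec A m) → Unique (toList xs) →
    ∀ i j → lookup xs i ≡ lookup xs j → i ≡ j
  unique⇒lookup-injective (x ∷ xs) u zero zero eq = refl
  unique⇒lookup-injective (x ∷ xs) (x∉ ∷ u) zero (suc j) eq = contradiction eq (All.lookup x∉ (lookup-∈ xs j))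
  unique⇒lookup-injective (x ∷ xs) (x∉ ∷ u) (suc i) zero eq = contradiction (sym eq) (All.lookup x∉ (lookup-∈ xs i))
  unique⇒lookup-injective (x ∷ xs) (x∉ ∷ u) (suc i) (suc j) eq = cong suc (unique⇒lookup-injective xs u i j eq)

  ∈-lookup⁻ : ∀ {m} (xs : Vec A m) {z} → z ∈ toList xs → ∃ λ i → lookup xs i ≡ z
  ∈-lookup⁻ (x ∷ xs) (here refl) = zero , refl
  ∈-lookup⁻ (x ∷ xs) (there p) = let i , eq = ∈-lookup⁻ xs p in suc i , eq

  lookup-injective⇒unique : ∀ {m} (xs : Vec A m) →
    (∀ i j → lookup xs i ≡ lookup xs j → i ≡ j) → Unique (toList xs)
  lookup-injective⇒unique [] inj = []
  lookup-injective⇒unique (x ∷ xs) inj =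
    ¬Any⇒All¬ _ (λ p → let i , eq = ∈-lookup⁻ xs p in 0≢suc (inj zero (suc i) (sym eq)))
    ∷ lookup-injective⇒unique xs (λ i j eq → suc-inj (inj (suc i) (suc j) eq))
    where
    0≢suc : ∀ {m} {i : Fin m} → zero ≢ Fin.suc i
    0≢suc ()
    suc-inj : ∀ {m} {i j : Fin m} → Fin.suc i ≡ suc j → i ≡ j
    suc-inj refl = refl

  split : ∀ m (xs : List A) → m ≤ length xs → ∃ λ ys → ∃ λ zs → xs ≡ ys ++ zs × length ys ≡ m
  split m xs m≤ = take m xs , drop m xs , sym (take++drop≡id m xs) ,
    trans (length-take m xs) (m≤n⇒m⊓n≡m m≤)

  drop-length : (xs : List A) {ys : List A} → drop (length xs) (xs ++ ys) ≡ ys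
  drop-length [] = refl
  drop-length (x ∷ xs) = drop-length xs

  reverse-loop : ∀ (v : A) m → reverse (v ∷ m ++ [ v ]) ≡ v ∷ reverse m ++ [ v ]
  reverse-loop v m = trans (unfold-reverse v (m ++ [ v ])) (cong (_++ [ v ]) (reverse-++ m [ v ]))

  hd-ʳ++-∈ : ∀ (d e : A) m {ys} → hd d ((e ∷ m) ʳ++ ys) ∈ e ∷ m
  hd-ʳ++-∈ d e [] = here refl
  hd-ʳ++-∈ d e (f ∷ m) = there (hd-ʳ++-∈ d f m)

  toVec : ∀ {m} (xs : List A) → length xs ≡ m → ∃ λ (c : Vec A m) → toList c ≡ xs
  toVec xs refl = fromList xs , Vec.toList∘fromList xs

  toList-inj : ∀ {m} (c c′ : Vec A m) → toList c ≡ toList c′ → c ≡ c′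
  toList-inj [] [] _ = refl
  toList-inj (x ∷ c) (y ∷ c′) eq = cong₂ _∷_ (∷-injectiveˡ eq) (toList-inj c c′ (∷-injectiveʳ eq))

-- Non-backtracking walks

module Walks {n : ℕ} (G : Graph n) where

  V : Set
  V = Fin n

  -- A walk is listed from its end back to its start, so that extending it is a cons.
  data Off (x : V) : List V → Set where
    [] : Off x []
    ne : ∀ {y l} → x ≢ y → Off x (y ∷ l)

  data NB : List V → Set where
    [-]  : ∀ {x} → NB (x ∷ [])
    step : ∀ {x y l} → Adj G x y → Off x l → NB (y ∷ l) → NB (x ∷ y ∷ l)

  adj-sym : ∀ {x y} → Adj G x y → Adj G y x
  adj-sym {x} {y} = subst T (Graph.sym G x y)

  adj-irrefl : ∀ {x} → ¬ Adj G x x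
  adj-irrefl {x} a = subst T (irrefl G x) a

  off? : ∀ x l → Dec (Off x l)
  off? x [] = yes []
  off? x (y ∷ l) with x ≟ y
  ... | yes eq = no λ { (ne x≢y) → x≢y eq }
  ... | no x≢y = yes (ne x≢y)

  off-prefix : ∀ {x} p {r} → Off x (p ++ r) → Off x p
  off-prefix [] o = []
  off-prefix (y ∷ p) (ne x≢y) = ne x≢y

  NB-prefix : ∀ x p {r} → NB (x ∷ p ++ r) → NB (x ∷ p)
  NB-prefix x [] nb = [-]
  NB-prefix x (y ∷ p) (step a o nb) = step a (off-prefix p o) (NB-prefix y p nb)

  NB-prefix′ : ∀ p {b r} → NB (p ++ b ∷ r) → NB (p ++ [ b ])
  NB-prefix′ [] nb = [-]
  NB-prefix′ (x ∷ p) {b} {r} nb =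
    NB-prefix x (p ++ [ b ]) (subst (λ l → NB (x ∷ l)) (sym (++-assoc p [ b ] r)) nb)

  NB-suffix : ∀ p {x r} → NB (p ++ x ∷ r) → NB (x ∷ r)
  NB-suffix [] nb = nb
  NB-suffix (x ∷ []) (step _ _ nb) = nb
  NB-suffix (x ∷ y ∷ p) (step _ _ nb) = NB-suffix (y ∷ p) nb

  NB-tail : ∀ {x} p {b r} → NB (x ∷ p ++ b ∷ r) → NB (p ++ b ∷ r)
  NB-tail [] (step _ _ nb) = nb
  NB-tail (_ ∷ _) (step _ _ nb) = nb

  NB-first : ∀ {x} p {b r} → NB (x ∷ p ++ b ∷ r) → Adj G x (hd b p)
  NB-first [] (step a _ _) = a
  NB-first (_ ∷ _) (step a _ _) = a

  -- The reversal moves the joint between the walks one vertex at a time. The last three hypotheses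
  -- are what non-backtracking demands at the joint, and each move turns a condition inside the
  -- first walk into one at the new joint.
  NB-ʳ++ : ∀ {x xs y ys} → NB (x ∷ xs) → NB (y ∷ ys) → Adj G x y → Off x ys → Off y xs →
    NB ((x ∷ xs) ʳ++ (y ∷ ys))
  NB-ʳ++ {xs = []} nbx nby a ox oy = step a ox nby
  NB-ʳ++ {xs = x′ ∷ xs} (step a′ o′ nbx) nby a ox (ne y≢x′) =
    NB-ʳ++ nbx (step a ox nby) (adj-sym a′) (ne (y≢x′ ∘ sym)) o′

  NB-reverse : ∀ {l} → NB l → NB (reverse l)
  NB-reverse [-] = [-]
  NB-reverse (step {l = []} a o nb) = step (adj-sym a) [] [-]
  NB-reverse (step {l = z ∷ l} a (ne x≢z) (step a′ o′ nb)) =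
    NB-ʳ++ nb (step (adj-sym a) [] [-]) (adj-sym a′) (ne (x≢z ∘ sym)) o′

  -- Both walks end at `x`: follow the second, then retrace the first. Only the turn at `x` could
  -- backtrack, and the last hypothesis excludes that. The cases merely let `hd` compute.
  NB-join : ∀ {x p b q b′} → NB (x ∷ p ++ [ b ]) → NB (x ∷ q ++ [ b′ ]) → hd b p ≢ hd b′ q →
    NB ((p ++ [ b ]) ʳ++ (x ∷ q ++ [ b′ ]))
  NB-join {p = []} {q = []} (step a o nb) nb′ h≢ = NB-ʳ++ nb nb′ (adj-sym a) (ne h≢) o
  NB-join {p = []} {q = _ ∷ _} (step a o nb) nb′ h≢ = NB-ʳ++ nb nb′ (adj-sym a) (ne h≢) o
  NB-join {p = _ ∷ _} {q = []} (step a o nb) nb′ h≢ = NB-ʳ++ nb nb′ (adj-sym a) (ne h≢) o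
  NB-join {p = _ ∷ _} {q = _ ∷ _} (step a o nb) nb′ h≢ = NB-ʳ++ nb nb′ (adj-sym a) (ne h≢) o

  closed-adjacent : ∀ {m} (xs : Vec V (suc m)) {z r} → NB (toList xs ++ z ∷ r) →
    (∀ (i : Fin m) → Adj G (lookup xs (inject₁ i)) (lookup xs (suc i))) × Adj G (lookup xs (fromℕ m)) z
  closed-adjacent (x ∷ []) (step a _ _) = (λ ()) , a
  closed-adjacent (x ∷ y ∷ xs) (step a _ nb) =
    let as , a′ = closed-adjacent (y ∷ xs) nb in (λ { zero → a ; (suc i) → as i }) , a′

  -- The free tail `r` allows a cycle to be cut out of a longer walk at a repeated vertex.
  NB⇒IsCycle : ∀ {m} (xs : Vec V (suc m)) {r} → 3 ≤ suc m → Unique (toList xs) →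
    NB (toList xs ++ lookup xs zero ∷ r) → IsCycle G xs
  NB⇒IsCycle xs 3≤ u nb =
    let as , a = closed-adjacent xs nb in 3≤ , unique⇒lookup-injective xs u , as , a

  IsCycle⇒NB : ∀ {m} (xs : Vec V (suc m)) → IsCycle G xs → NB (toList xs ++ [ lookup xs zero ])
  IsCycle⇒NB (x ∷ []) (s≤s () , _)
  IsCycle⇒NB (x ∷ y ∷ []) (s≤s (s≤s ()) , _)
  IsCycle⇒NB (x ∷ y ∷ z ∷ xs) (_ , inj , as , a) with lookup-injective⇒unique (x ∷ y ∷ z ∷ xs) inj
  ... | x∉@(_ ∷ x≢z ∷ _) ∷ u = step (as zero) (ne x≢z) (path (y ∷ z ∷ xs) u (as ∘ suc) a x∉)
    where
    -- `e` is the first vertex of the whole cycle; its absence from the rest gives the `Off`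
    -- condition at the last turn.
    path : ∀ {m} (xs : Vec V (suc m)) {e} → Unique (toList xs) →
      (∀ (i : Fin m) → Adj G (lookup xs (inject₁ i)) (lookup xs (suc i))) →
      Adj G (lookup xs (fromℕ m)) e → All (e ≢_) (toList xs) → NB (toList xs ++ [ e ])
    path (x ∷ []) u as a e∉ = step a [] [-]
    path (x ∷ y ∷ []) u as a (e≢x ∷ _) = step (as zero) (ne (e≢x ∘ sym)) (step a [] [-])
    path (x ∷ y ∷ z ∷ xs) ((_ ∷ x≢z ∷ _) ∷ u) as a (_ ∷ e∉) =
      step (as zero) (ne x≢z) (path (y ∷ z ∷ xs) u (as ∘ suc) a e∉)

  cycle⇒closed : ∀ {g v} (c : Vec V g) → IsCycle G c → RootedCanonical v c →
    ∃ λ m → toList c ++ [ v ] ≡ v ∷ m ++ [ v ] × suc (length m) ≡ g × NB (v ∷ m ++ [ v ]) ×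
      toℕ (hd v m) < toℕ (hd v (reverse m))
  cycle⇒closed {v = v} c@(x ∷ y ∷ xs) cyc (refl , lt) =
    toList (y ∷ xs) , refl , cong suc (Vec.length-toList (y ∷ xs)) , IsCycle⇒NB c cyc ,
    subst (λ k → toℕ y < toℕ k) (sym (hd-ʳ++ v (y ∷ xs) [])) lt

  closed⇒cycle : ∀ {g v} (c : Vec V g) m → toList c ≡ v ∷ m → 3 ≤ g → Unique (v ∷ m) →
    NB (v ∷ m ++ [ v ]) → toℕ (hd v m) < toℕ (hd v (reverse m)) → IsCycle G c × RootedCanonical v c
  closed⇒cycle (x ∷ []) m eq (s≤s ()) u nb lt
  closed⇒cycle {v = v} c@(x ∷ y ∷ xs) m refl 3≤g u nb lt =
    NB⇒IsCycle c 3≤g u nb , refl , subst (λ k → toℕ y < toℕ k) (hd-ʳ++ v (y ∷ xs) []) lt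

  -- Enumerating the walks that extend a given one

  nbrs : V → List V
  nbrs x = filter (λ y → T? (adj G x y)) (allFin n)

  length-nbrs : ∀ x → length (nbrs x) ≡ degree G x
  length-nbrs x = go id
    where
    go : ∀ {m} (g : Fin m → V) →
      length (filter (λ y → T? (adj G x y)) (List.tabulate g)) ≡ ∣ tabulate (adj G x ∘ g) ∣
    go {zero} g = refl
    go {suc m} g with adj G x (g zero)
    ... | true = cong suc (go (g ∘ suc))
    ... | false = go (g ∘ suc)

  nbrs-unique : ∀ x → Unique (nbrs x)
  nbrs-unique x = Unique.filter⁺ _ (Unique.allFin⁺ n)

  ∈-nbrs⁺ : ∀ {x y} → Adj G x y → y ∈ nbrs x
  ∈-nbrs⁺ {y = y} a = ∈-filter⁺ _ (∈-allFin y) a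

  ∈-nbrs⁻ : ∀ {x y} → y ∈ nbrs x → Adj G x y
  ∈-nbrs⁻ {x} y∈ = proj₂ (∈-filter⁻ (λ y → T? (adj G x y)) {xs = allFin n} y∈)

  ext : List V → List (List V)
  ext [] = []
  ext (x ∷ l) = map (_∷ x ∷ l) (filter (λ y → off? y l) (nbrs x))

  ∈-ext⁻ : ∀ r {l} → NB r → l ∈ ext r → NB l × ∃ λ y → l ≡ y ∷ r
  ∈-ext⁻ (x ∷ r) nb l∈ with ∈-map⁻ (_∷ x ∷ r) l∈
  ... | y , y∈ , refl with ∈-filter⁻ (λ y → off? y r) {xs = nbrs x} y∈
  ... | y∈nbrs , off = step (adj-sym (∈-nbrs⁻ y∈nbrs)) off nb , y , refl

  ∈-ext⁺ : ∀ {y x r} → NB (y ∷ x ∷ r) → y ∷ x ∷ r ∈ ext (x ∷ r)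
  ∈-ext⁺ {x = x} {r} (step a off nb) =
    ∈-map⁺ (_∷ x ∷ r) (∈-filter⁺ (λ y → off? y r) (∈-nbrs⁺ (adj-sym a)) off)

  ext-unique : ∀ r → Unique (ext r)
  ext-unique [] = []
  ext-unique (x ∷ r) = Unique.map⁺ ∷-injectiveˡ (Unique.filter⁺ _ (nbrs-unique x))

  ext-tail : ∀ r {l} → l ∈ ext r → drop 1 l ≡ r
  ext-tail (x ∷ r) l∈ with ∈-map⁻ (_∷ x ∷ r) l∈
  ... | _ , _ , refl = refl

  grow : ℕ → List V → List (List V)
  grow zero r = [ r ]
  grow (suc m) r = concatMap ext (grow m r)

  -- Dropping its end recovers the walk that was extended, so different walks have disjoint lists of
  -- extensions.
  grow-unique : ∀ m r → Unique (grow m r)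
  grow-unique zero r = [] ∷ []
  grow-unique (suc m) r = concatMap-unique ext ext-unique
    (λ {x} {x′} p q → trans (sym (ext-tail x p)) (ext-tail x′ q)) (grow-unique m r)

  ∈-grow⁻ : ∀ m {r l} → NB r → l ∈ grow m r → NB l × ∃ λ p → l ≡ p ++ r × length p ≡ m
  ∈-grow⁻ zero nb (here refl) = nb , [] , refl , refl
  ∈-grow⁻ (suc m) nb l∈ with find (∈-concatMap⁻ ext l∈)
  ... | l′ , l′∈ , l∈ext with ∈-grow⁻ m nb l′∈
  ... | nb′ , p , refl , refl with ∈-ext⁻ l′ nb′ l∈ext
  ... | nb″ , y , refl = nb″ , y ∷ p , refl , refl

  ∈-grow⁺ : ∀ p {b r} → NB (p ++ b ∷ r) → p ++ b ∷ r ∈ grow (length p) (b ∷ r)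
  ∈-grow⁺ [] nb = here refl
  ∈-grow⁺ (x ∷ []) nb = ∈-concatMap⁺ ext {xs = [ _ ]} (here (∈-ext⁺ nb))
  ∈-grow⁺ (x ∷ y ∷ p) nb@(step _ _ nb′) = ∈-concatMap⁺ ext (lose (∈-grow⁺ (y ∷ p) nb′) (∈-ext⁺ nb))

  -- Numbers of walks in a regular graph

  module Regular (q : ℕ) (regular : Regular (suc q) G) where

    length-nbrs-suc : ∀ x → length (nbrs x) ≡ suc q
    length-nbrs-suc x = trans (length-nbrs x) (regular x)

    length-ext-single : ∀ x → length (ext [ x ]) ≡ suc q
    length-ext-single x = trans (length-map (_∷ [ x ]) (filter (λ y → off? y []) (nbrs x)))
      (trans (cong length (filter-all (λ y → off? y []) (All.tabulate {xs = nbrs x} λ _ → []))) (length-nbrs-suc x))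

    -- Of the q + 1 neighbours of `x`, the previous vertex `p` is the only one refused.
    length-ext : ∀ {x p r} → NB (x ∷ p ∷ r) → length (ext (x ∷ p ∷ r)) ≡ q
    length-ext {x} {p} {r} (step a _ _) = trans (length-map _ (filter P? (nbrs x)))
      (suc-injective (trans (cong (_+ length (filter P? (nbrs x))) (sym one))
        (trans (+-comm (length (filter (¬? ∘ P?) (nbrs x))) _) (trans (filter-complement P? (nbrs x)) (length-nbrs-suc x)))))
      where
      P? = λ y → off? y (p ∷ r)
      ¬off : ∀ {y} → ¬ Off y (p ∷ r) → y ≡ p
      ¬off {y} ¬o with y ≟ p
      ... | yes eq = eq
      ... | no y≢p = contradiction (ne y≢p) ¬o
      one : length (filter (¬? ∘ P?) (nbrs x)) ≡ 1
      one = ≤-antisym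
        (pigeonhole (λ y y′ → y ≡ y′) [ p ] (Unique.filter⁺ (¬? ∘ P?) (nbrs-unique x))
          (λ y∈ → p , here refl , ¬off (proj₂ (∈-filter⁻ (¬? ∘ P?) {xs = nbrs x} y∈)))
          (λ e e′ → trans e (sym e′)))
        (∈-length (∈-filter⁺ (¬? ∘ P?) (∈-nbrs⁺ a) λ { (ne p≢p) → p≢p refl }))

    length-grow : ∀ m {x p r} → NB (x ∷ p ∷ r) → length (grow m (x ∷ p ∷ r)) ≡ q ^ m
    length-grow zero nb = refl
    length-grow (suc m) {x} {p} {r} nb = trans
      (length-concatMap-const ext q (grow m (x ∷ p ∷ r)) eq)
      (trans (cong (_* q) (length-grow m nb)) (*-comm (q ^ m) q))
      where
      eq : ∀ {l} → l ∈ grow m (x ∷ p ∷ r) → length (ext l) ≡ q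
      eq l∈ with ∈-grow⁻ m nb l∈
      ... | nb′ , [] , refl , _ = length-ext nb′
      ... | nb′ , _ ∷ [] , refl , _ = length-ext nb′
      ... | nb′ , _ ∷ _ ∷ _ , refl , _ = length-ext nb′

    -- The first step has no previous vertex to avoid, whence the single factor `suc q`.
    length-grow-single : ∀ m v → length (grow (suc m) [ v ]) ≡ suc q * q ^ m
    length-grow-single zero v = trans (cong length (++-identityʳ (ext [ v ])))
      (trans (length-ext-single v) (sym (*-identityʳ (suc q))))
    length-grow-single (suc m) v = trans
      (length-concatMap-const ext q (grow (suc m) [ v ]) eq)
      (trans (cong (_* q) (length-grow-single m v)) (trans (*-assoc (suc q) (q ^ m) q) (cong (suc q *_) (*-comm (q ^ m) q))))
      where
      eq : ∀ {l} → l ∈ grow (suc m) [ v ] → length (ext l) ≡ q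
      eq l∈ with ∈-grow⁻ (suc m) [-] l∈
      ... | nb′ , _ ∷ [] , refl , _ = length-ext nb′
      ... | nb′ , _ ∷ _ ∷ _ , refl , _ = length-ext nb′

  -- Bounded distance

  Reach : ℕ → V → V → Set
  Reach zero v z = z ≡ v
  Reach (suc m) v z = z ≡ v ⊎ ∃ λ y → Adj G z y × Reach m v y

  reach? : ∀ m v z → Dec (Reach m v z)
  reach? zero v z = z ≟ v
  reach? (suc m) v z = (z ≟ v) ⊎-dec any? (λ y → T? (adj G z y) ×-dec reach? m v y)

  reach-refl : ∀ m {v} → Reach m v v
  reach-refl zero = refl
  reach-refl (suc m) = inj₁ refl

  reach-mono : ∀ {m m′} → m ≤ m′ → ∀ {v z} → Reach m v z → Reach m′ v z
  reach-mono z≤n {v} refl = reach-refl _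
  reach-mono (s≤s le) (inj₁ eq) = inj₁ eq
  reach-mono (s≤s le) (inj₂ (y , a , r)) = inj₂ (y , a , reach-mono le r)

  reach-extend : ∀ m {u v z} → Adj G u v → Reach m u z → Reach (suc m) v z
  reach-extend zero {v = v} a refl = inj₂ (v , a , refl)
  reach-extend (suc m) a (inj₁ refl) = inj₂ (_ , a , reach-refl _)
  reach-extend (suc m) a (inj₂ (y , a′ , r)) = inj₂ (y , a′ , reach-extend m a r)

  reach-sym : ∀ m {v z} → Reach m v z → Reach m z v
  reach-sym zero refl = refl
  reach-sym (suc m) (inj₁ refl) = inj₁ refl
  reach-sym (suc m) (inj₂ (y , a , r)) = reach-extend m (adj-sym a) (reach-sym m r)

  NB⇒Reach : ∀ p {b} → NB (p ++ [ b ]) → Reach (length p) b (hd b p)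
  NB⇒Reach [] nb = refl
  NB⇒Reach (x ∷ []) {b} (step a _ _) = inj₂ (b , a , refl)
  NB⇒Reach (x ∷ y ∷ p) (step a _ nb) = inj₂ (y , a , NB⇒Reach (y ∷ p) nb)

  -- A step back to the last vertex but one is cancelled against the step before it, which only
  -- shortens the walk.
  Reach⇒NB : ∀ m {b z} → Reach m b z → ∃ λ p → NB (p ++ [ b ]) × hd b p ≡ z × length p ≤ m
  Reach⇒NB zero refl = [] , [-] , refl , z≤n
  Reach⇒NB (suc m) (inj₁ refl) = [] , [-] , refl , z≤n
  Reach⇒NB (suc m) {b} {z} (inj₂ (y , a , r)) with Reach⇒NB m r
  ... | [] , nb , refl , len = [ z ] , step a [] nb , refl , s≤s z≤n
  ... | y ∷ [] , nb , refl , len with z ≟ b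
  ...   | yes refl = [] , [-] , refl , z≤n
  ...   | no z≢b = z ∷ y ∷ [] , step a (ne z≢b) nb , refl , s≤s len
  Reach⇒NB (suc m) {b} {z} (inj₂ (y , a , r)) | y ∷ y′ ∷ p , nb@(step _ _ nb′) , refl , len with z ≟ y′
  ...   | yes refl = y′ ∷ p , nb′ , refl , ≤-trans (<⇒≤ len) (n≤1+n m)
  ...   | no z≢y′ = z ∷ y ∷ y′ ∷ p , step a (ne z≢y′) nb , refl , s≤s len

  -- Uniqueness of short walks under the girth condition

  module Girth (s : ℕ) (s>0 : 0 < s) (no-short : ∀ m → m < 2 * s + 1 → ¬ HasCycleOfLength G m) where

    -- If `x` recurs in the walk, the stretch `pre` between its two occurrences is neither empty (no
    -- loops) nor a single vertex (no backtracking), so `x ∷ pre` is a cycle. It omits the second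
    -- occurrence of `x` and is therefore shorter than the girth.
    NB⇒unique : ∀ {l} → NB l → length l ≤ 2 * s + 1 → Unique l
    NB⇒unique [-] _ = [] ∷ []
    NB⇒unique {x ∷ y ∷ l} nb@(step _ _ nb′) len = ¬Any⇒All¬ _ x∉ ∷ u
      where
      u : Unique (y ∷ l)
      u = NB⇒unique nb′ (<⇒≤ len)
      no-return : ∀ pre {post} → y ∷ l ≡ pre ++ x ∷ post → ⊥
      no-return [] refl with nb
      ... | step a _ _ = adj-irrefl a
      no-return (_ ∷ []) refl with nb
      ... | step _ (ne x≢x) _ = x≢x refl
      no-return pre@(a ∷ b ∷ pre′) {post} eq = no-short (length (x ∷ pre)) short (fromList (x ∷ pre) , cycle)
        where
        u′ : Unique (pre ++ x ∷ post)
        u′ = subst Unique eq u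
        short : length (x ∷ pre) < 2 * s + 1
        short = ≤-trans (s≤s (≤-trans (+-monoʳ-≤ 1 (m≤m+n (length pre) (length post)))
          (≤-reflexive (trans (cong suc (sym (length-++ pre))) (trans (sym (length-++-sucʳ pre x post)) (cong length (sym eq))))))) len
        x∉pre : x ∉ pre
        x∉pre x∈ = unique-++-disjoint pre u′ x∈ (here refl)
        cycle : IsCycle G (fromList (x ∷ pre))
        cycle = NB⇒IsCycle (fromList (x ∷ pre)) (s≤s (s≤s (s≤s z≤n)))
          (subst Unique (sym (Vec.toList∘fromList (x ∷ pre))) (¬Any⇒All¬ _ x∉pre ∷ unique-++⁻ˡ pre u′))
          (subst (λ k → NB (k ++ x ∷ post)) (sym (Vec.toList∘fromList (x ∷ pre))) (subst (λ k → NB (x ∷ k)) eq nb))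
      x∉ : x ∉ y ∷ l
      x∉ x∈ = let pre , _ , eq = ∈-∃++ x∈ in no-return pre eq

    -- Strip the common final stretch. If the walks then arrive at `x` from different vertices,
    -- `NB-join` makes of them one walk with at most 2s + 1 vertices that has `b` at both ends,
    -- against `NB⇒unique`.
    walk-unique : ∀ p q {b} → NB (p ++ [ b ]) → NB (q ++ [ b ]) → hd b p ≡ hd b q →
      length p + length q ≤ 2 * s → p ≡ q
    walk-unique [] [] _ _ _ _ = refl
    walk-unique [] (x ∷ q) {b} _ nb refl len with NB⇒unique nb
      (≤-trans (≤-reflexive (trans (cong suc (length-++ q)) refl)) (+-monoˡ-≤ 1 len))
    ... | b∉ ∷ _ = contradiction refl (All.lookup b∉ (∈-++⁺ʳ q (here refl)))
    walk-unique (x ∷ p) [] {b} nb _ refl len with NB⇒unique nb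
      (≤-trans (≤-reflexive (cong suc (length-++ p))) (+-monoˡ-≤ 1 (≤-trans (≤-reflexive (sym (+-identityʳ _))) len)))
    ... | b∉ ∷ _ = contradiction refl (All.lookup b∉ (∈-++⁺ʳ p (here refl)))
    walk-unique (x ∷ p) (x ∷ q) {b} nb nb′ refl len with hd b p ≟ hd b q
    ... | yes eq = cong (x ∷_) (walk-unique p q (NB-tail p nb) (NB-tail q nb′) eq
                     (≤-trans (+-mono-≤ (n≤1+n (length p)) (n≤1+n (length q))) len))
    ... | no h≢ = ⊥-elim (unique-ʳ++-disjoint (p ++ [ b ]) {x ∷ q ++ [ b ]} {b}
        (NB⇒unique (NB-join {p = p} {q = q} nb nb′ h≢) total)
        (∈-++⁺ʳ p (here refl)) (∈-++⁺ʳ (x ∷ q) (here refl)))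
      where
      open ≤-Reasoning
      total : length ((p ++ [ b ]) ʳ++ (x ∷ q ++ [ b ])) ≤ 2 * s + 1
      total = begin
        length ((p ++ [ b ]) ʳ++ (x ∷ q ++ [ b ])) ≡⟨ length-ʳ++ (p ++ [ b ]) ⟩
        length (p ++ [ b ]) + length (x ∷ q ++ [ b ]) ≡⟨ cong₂ _+_ (length-++ p) (length-++ (x ∷ q)) ⟩
        length p + 1 + (length (x ∷ q) + 1) ≡⟨ cong (_+ (length (x ∷ q) + 1)) (+-comm (length p) 1) ⟩
        length (x ∷ p) + (length (x ∷ q) + 1) ≡⟨ +-assoc (length (x ∷ p)) _ _ ⟨
        length (x ∷ p) + length (x ∷ q) + 1 ≤⟨ +-monoˡ-≤ 1 len ⟩
        2 * s + 1 ∎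

    -- Closing walks and leaving walks

    Ball : V → V → Set
    Ball = Reach s

    ball? : ∀ v z → Dec (Ball v z)
    ball? = reach? s

    inside : V → List (List V)
    inside v = filter (λ l → ball? v (hd v l)) (grow (suc s) [ v ])

    -- These walks stand for the edges that leave the ball: by `crossing`, each such edge is the
    -- last step of one of them.
    cut : V → List (List V)
    cut v = filter (λ l → ¬? (ball? v (hd v l))) (grow (suc s) [ v ])

    -- Closed walks of length g, listed with both copies of the base point.
    loops : V → List (List V)
    loops v = filter (λ l → hd v l ≟ v) (grow (2 * s + 1) [ v ])

    ∈-loops⁻ : ∀ {v l} → l ∈ loops v → NB l × ∃ λ m → l ≡ v ∷ m ++ [ v ] × length m ≡ 2 * s
    ∈-loops⁻ {v} l∈ with ∈-filter⁻ (λ l → hd v l ≟ v) {xs = grow (2 * s + 1) [ v ]} l∈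
    ... | l∈grow , h≡v with ∈-grow⁻ (2 * s + 1) [-] l∈grow
    ... | nb , [] , refl , len = contradiction (trans len (+-comm (2 * s) 1)) λ ()
    ... | nb , x ∷ m , refl , len with h≡v
    ... | refl = nb , m , refl , suc-injective (trans len (+-comm (2 * s) 1))

    ∈-loops⁺ : ∀ {v m} → NB (v ∷ m ++ [ v ]) → length m ≡ 2 * s → v ∷ m ++ [ v ] ∈ loops v
    ∈-loops⁺ {v} {m} nb len = ∈-filter⁺ (λ l → hd v l ≟ v)
      (subst (λ k → v ∷ m ++ [ v ] ∈ grow k [ v ]) (trans (cong suc len) (+-comm 1 (2 * s))) (∈-grow⁺ (v ∷ m) nb)) refl

    loops-unique : ∀ v → Unique (loops v)
    loops-unique v = Unique.filter⁺ _ (grow-unique (2 * s + 1) [ v ])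

    ∈-inside⁺ : ∀ {v} p → NB (p ++ [ v ]) → length p ≡ suc s → Ball v (hd v p) → p ++ [ v ] ∈ inside v
    ∈-inside⁺ {v} p nb len b = ∈-filter⁺ (λ l → ball? v (hd v l))
      (subst (λ k → p ++ [ v ] ∈ grow k [ v ]) len (∈-grow⁺ p nb)) (subst (Ball v) (sym (hd-++ v p)) b)

    ∈-cut⁺ : ∀ {v} p → NB (p ++ [ v ]) → length p ≡ suc s → ¬ Ball v (hd v p) → p ++ [ v ] ∈ cut v
    ∈-cut⁺ {v} p nb len ¬b = ∈-filter⁺ (λ l → ¬? (ball? v (hd v l)))
      (subst (λ k → p ++ [ v ] ∈ grow k [ v ]) len (∈-grow⁺ p nb)) (¬b ∘ subst (Ball v) (hd-++ v p))

    tail-length : ∀ {x : V} {m} pre r → x ∷ m ≡ pre ++ r → length m ≡ 2 * length pre → length r ≡ suc (length pre)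
    tail-length pre r eq len = +-cancelˡ-≡ (length pre) _ _ (trans (sym (length-++ pre)) (trans (cong length (sym eq))
      (trans (cong suc (trans len (cong (length pre +_) (+-identityʳ (length pre))))) (sym (+-suc (length pre) (length pre))))))

    -- The loop is cut after s + 1 steps: `z ∷ p ++ [ v ]` is walked first, and `pre` is the way of
    -- length s from `z` back to `v`.
    loops-split : ∀ {v l} → l ∈ loops v → ∃ λ pre → ∃ λ z → ∃ λ p →
      l ≡ pre ++ z ∷ p ++ [ v ] × length pre ≡ s × length p ≡ s × hd z pre ≡ v × drop s l ≡ z ∷ p ++ [ v ] × NB l
    loops-split {v} l∈ with ∈-loops⁻ l∈
    ... | nb , m , refl , len with split s (v ∷ m) (≤-trans (m≤m+n s (s + 0)) (≤-trans (≤-reflexive (sym len)) (n≤1+n _)))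
    ... | pre , [] , eq , refl = contradiction (tail-length pre [] eq len) λ ()
    ... | pre , z ∷ p , eq , refl = pre , z , p , l≡ , refl , suc-injective (tail-length pre (z ∷ p) eq len) , h≡ ,
          trans (cong (drop (length pre)) l≡) (drop-length pre) , nb
      where
      l≡ : v ∷ m ++ [ v ] ≡ pre ++ z ∷ p ++ [ v ]
      l≡ = trans (cong (_++ [ v ]) eq) (++-assoc pre (z ∷ p) [ v ])
      h≡ : hd z pre ≡ v
      h≡ = trans (sym (hd-++ v pre)) (cong (hd v) (sym l≡))

    -- Forgetting the last s steps leaves a walk whose end is in the ball, as those steps lead from
    -- it to `v`. Nothing is lost, because walks of length s between given ends are unique.
    loops≤inside : ∀ v → length (loops v) ≤ length (inside v)
    loops≤inside v = pigeonhole R (inside v) (loops-unique v) total inj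
      where
      R : List V → List V → Set
      -- The injectivity that `pigeonhole` asks for comes without membership, so the relation
      -- carries it.
      R l a = l ∈ loops v × a ≡ drop s l
      total : ∀ {l} → l ∈ loops v → ∃ λ a → a ∈ inside v × R l a
      total l∈ with loops-split l∈
      ... | pre , z , p , refl , refl , lenp , refl , deq , nb =
        z ∷ p ++ [ v ] , ∈-inside⁺ (z ∷ p) (NB-suffix pre nb) (cong suc lenp)
          (reach-sym s (NB⇒Reach pre (NB-prefix′ pre nb))) , l∈ , sym deq
      inj : ∀ {l l′ a} → R l a → R l′ a → l ≡ l′
      inj (l∈ , refl) (l∈′ , eq) with loops-split l∈ | loops-split l∈′
      ... | pre , z , p , refl , len , _ , h , deq , nb | pre′ , z′ , p′ , refl , len′ , _ , h′ , deq′ , nb′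
        with trans (sym deq) (trans eq deq′)
      ... | r≡ with ∷-injectiveˡ r≡
      ... | refl = cong₂ _++_ (walk-unique pre pre′ (NB-prefix′ pre nb) (NB-prefix′ pre′ nb′) (trans h (sym h′))
              (≤-reflexive (trans (cong₂ _+_ len len′) (cong (s +_) (sym (+-identityʳ s)))))) r≡

    -- The end `z` of the walk is also reached by a walk `r` of length at most s, along which the
    -- walk can be closed up.
    inside≤loops : ∀ v → length (inside v) ≤ length (loops v)
    inside≤loops v = pigeonhole (λ a l → a ≡ drop s l) (loops v) (Unique.filter⁺ _ (grow-unique (suc s) [ v ]))
      total (λ e e′ → trans e (sym e′))
      where
      total : ∀ {a} → a ∈ inside v → ∃ λ l → l ∈ loops v × a ≡ drop s l
      total a∈ with ∈-filter⁻ (λ l → ball? v (hd v l)) {xs = grow (suc s) [ v ]} a∈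
      ... | a∈grow , b with ∈-grow⁻ (suc s) [-] a∈grow
      ... | nb , z ∷ p , refl , len with Reach⇒NB s b
      ... | r , nbr , h , lenr with m≤n⇒m<n∨m≡n lenr
      -- With `r` shorter than s the two lengths add up to at most 2s, so the walks would coincide,
      -- yet their lengths differ.
      ... | inj₁ r<s = contradiction
            (cong length (walk-unique (z ∷ p) r nb nbr (sym h)
              (≤-trans (+-monoˡ-≤ (length r) (≤-reflexive len)) (≤-trans (≤-reflexive (sym (+-suc s (length r))))
                (+-monoʳ-≤ s (≤-trans r<s (≤-reflexive (sym (+-identityʳ s)))))))))
            (λ e → <⇒≱ r<s (≤-trans (n≤1+n s) (≤-reflexive (trans (sym len) e))))
      total a∈ | a∈grow , b | nb , z ∷ p , refl , len | [] , nbr , h , lenr | inj₂ r≡s =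
        contradiction s>0 (λ s>0 → <⇒≢ s>0 r≡s)
      total a∈ | a∈grow , b | nb , z ∷ p , refl , len | z ∷ r , nbr , refl , lenr | inj₂ r≡s =
        v ∷ (reverse r ++ z ∷ p) ++ [ v ] , ∈-loops⁺ nbl lenl ,
        sym (trans (cong₂ drop (sym r≡s) (sym (cong (v ∷_) (sym (++-assoc (reverse r) (z ∷ p) [ v ])))))
          (trans (cong (λ k → drop k (reverse r ++ z ∷ p ++ [ v ])) (sym (length-reverse r))) (drop-length (reverse r))))
        where
        lens : length r + suc (length p) ≡ 2 * s
        lens = trans (cong (length r +_) len) (trans (+-suc (length r) s) (trans (cong (_+ s) r≡s) (cong (s +_) (sym (+-identityʳ s)))))
        -- Without their common end `z` the walks have lengths s - 1 and s; agreeing in the next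
        -- vertex, they would be equal by `walk-unique`.
        h≢ : hd v r ≢ hd v p
        h≢ e = contradiction
          (cong length (walk-unique r p (NB-tail r nbr) (NB-tail p nb) e (≤-trans (+-monoʳ-≤ (length r) (n≤1+n _)) (≤-reflexive lens))))
          (λ e → <⇒≢ (n<1+n (length r)) (trans e (trans (suc-injective len) (sym r≡s))))
        nbl : NB (v ∷ (reverse r ++ z ∷ p) ++ [ v ])
        nbl = subst NB (trans (++-ʳ++ r) (cong (v ∷_) (trans (ʳ++-defn r) (sym (++-assoc (reverse r) (z ∷ p) [ v ])))))
          (NB-join {p = r} {q = p} nbr nb h≢)
        lenl : length (reverse r ++ z ∷ p) ≡ 2 * s
        lenl = trans (length-++ (reverse r)) (trans (cong (_+ suc (length p)) (length-reverse r)) lens)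

    -- The two orientations of a girth cycle

    Canonical : V → List V → Set
    Canonical v l = toℕ (hd v (drop 1 l)) < toℕ (hd v (drop 1 (reverse l)))

    canonical? : ∀ v l → Dec (Canonical v l)
    canonical? v l = toℕ (hd v (drop 1 l)) <? toℕ (hd v (drop 1 (reverse l)))

    canonicals noncanonicals : V → List (List V)
    canonicals v = filter (canonical? v) (loops v)
    noncanonicals v = filter (¬? ∘ canonical? v) (loops v)

    reverse-∈-loops : ∀ {v l} → l ∈ loops v → reverse l ∈ loops v
    reverse-∈-loops {v} l∈ with ∈-loops⁻ l∈
    ... | nb , m , refl , len = subst (_∈ loops v) (sym (reverse-loop v m))
            (∈-loops⁺ (subst NB (reverse-loop v m) (NB-reverse nb)) (trans (length-reverse m) len))

    -- Reversal swaps the two compared neighbours of `v`, so only their equality has to be excluded.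
    -- They are the ends of `m`, a non-backtracking walk on 2s > 1 vertices, and hence distinct.
    canonical-total : ∀ {v l} → l ∈ loops v → ¬ Canonical v l → Canonical v (reverse l)
    canonical-total {v} l∈ ¬c with ∈-loops⁻ l∈
    ... | nb , [] , refl , len = contradiction s>0 (λ s>0 → <⇒≢ (≤-trans s>0 (m≤m+n s (s + 0))) len)
    ... | nb , c ∷ [] , refl , len = contradiction len (1≢2* s)
      where
      1≢2* : ∀ s → 1 ≢ 2 * s
      1≢2* (suc s) e = contradiction (trans (suc-injective e) (+-suc s (s + 0))) λ ()
    ... | nb , m@(c ∷ e ∷ m′) , refl , len rewrite reverse-involutive (v ∷ m ++ [ v ]) =
          ≤∧≢⇒< (≮⇒≥ ¬c) λ eq → All.lookup c∉ (hd-ʳ++-∈ v e m′)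
            (trans (toℕ-injective (sym eq)) (trans (cong (hd v ∘ drop 1) (reverse-loop v m)) (hd-++ v (reverse m))))
      where
      c∉ : All (c ≢_) (e ∷ m′)
      c∉ with NB⇒unique (NB-prefix c (e ∷ m′) (NB-suffix [ v ] nb)) (≤-trans (≤-reflexive len) (m≤m+n (2 * s) 1))
      ... | c∉ ∷ _ = c∉

    reversal-≡ : ∀ v → length (canonicals v) ≡ length (noncanonicals v)
    reversal-≡ v = ≤-antisym
      (pigeonhole (λ l l′ → l′ ≡ reverse l) (noncanonicals v) (Unique.filter⁺ _ (loops-unique v))
        (λ {l} l∈ → let l∈loops , c = ∈-filter⁻ (canonical? v) {xs = loops v} l∈ in
          reverse l , ∈-filter⁺ (¬? ∘ canonical? v) (reverse-∈-loops l∈loops)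
            (λ c′ → <-asym c (subst (λ k → toℕ (hd v (drop 1 (reverse l))) < toℕ (hd v (drop 1 k))) (reverse-involutive l) c′)) , refl)
        (λ e e′ → reverse-injective (trans (sym e) e′)))
      (pigeonhole (λ l l′ → l′ ≡ reverse l) (canonicals v) (Unique.filter⁺ _ (loops-unique v))
        (λ {l} l∈ → let l∈loops , ¬c = ∈-filter⁻ (¬? ∘ canonical? v) {xs = loops v} l∈ in
          reverse l , ∈-filter⁺ (canonical? v) (reverse-∈-loops l∈loops) (canonical-total l∈loops ¬c) , refl)
        (λ e e′ → reverse-injective (trans (sym e) e′)))

    module _ {v : V} {λ′ : ℕ} (cycles : CyclesThrough G (2 * s + 1) v λ′) where

      L : List (Vec V (2 * s + 1))
      L = proj₁ cycles

      L⇒ : ∀ {c} → c ∈ L → IsCycle G c × RootedCanonical v c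
      L⇒ {c} = proj₂ (proj₂ (proj₂ (proj₂ cycles)) c)

      ⇒L : ∀ {c} → IsCycle G c × RootedCanonical v c → c ∈ L
      ⇒L {c} = proj₁ (proj₂ (proj₂ (proj₂ cycles)) c)

      -- A listed cycle becomes a canonical loop by repeating `v` at the end. Conversely, a loop of
      -- girth length has no other repetition, by `NB⇒unique`, and so comes from a cycle.
      canonicals-≡ : length (canonicals v) ≡ λ′
      canonicals-≡ = trans (≤-antisym
        (pigeonhole (λ l c → l ≡ toList c ++ [ v ]) L (Unique.filter⁺ _ (loops-unique v)) toL (λ e e′ → trans e (sym e′)))
        (pigeonhole (λ c l → l ≡ toList c ++ [ v ]) (canonicals v) (proj₁ (proj₂ (proj₂ cycles))) fromL
          (λ {c} {c′} e e′ → toList-inj c c′ (∷ʳ-injectiveˡ (toList c) (toList c′) (trans (sym e) e′)))))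
        (proj₁ (proj₂ cycles))
        where
        toL : ∀ {l} → l ∈ canonicals v → ∃ λ c → c ∈ L × l ≡ toList c ++ [ v ]
        toL l∈ with ∈-filter⁻ (canonical? v) {xs = loops v} l∈
        ... | l∈loops , can with ∈-loops⁻ l∈loops
        ... | nb , m , refl , len with toVec (v ∷ m) (trans (cong suc len) (+-comm 1 (2 * s)))
        ... | c , eq = c , ⇒L (closed⇒cycle c m eq 3≤g
                (NB⇒unique (NB-prefix v m nb) (≤-reflexive (trans (cong suc len) (+-comm 1 (2 * s))))) nb
                (subst₂ (λ a b → toℕ a < toℕ b) (hd-++ v m)
                  (trans (cong (hd v ∘ drop 1) (reverse-loop v m)) (hd-++ v (reverse m))) can)) ,
              cong (_++ [ v ]) (sym eq)
          where
          3≤g : 3 ≤ 2 * s + 1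
          3≤g = +-monoˡ-≤ 1 (*-monoʳ-≤ 2 s>0)
        fromL : ∀ {c} → c ∈ L → ∃ λ l → l ∈ canonicals v × l ≡ toList c ++ [ v ]
        fromL {c} c∈ with cycle⇒closed c (proj₁ (L⇒ c∈)) (proj₂ (L⇒ c∈))
        ... | m , eq , len , nb , lt = v ∷ m ++ [ v ] ,
              ∈-filter⁺ (canonical? v) (∈-loops⁺ nb (suc-injective (trans len (+-comm (2 * s) 1)))) can , sym eq
          where
          can : Canonical v (v ∷ m ++ [ v ])
          can rewrite reverse-loop v m | hd-++ v m {v} {[]} | hd-++ v (reverse m) {v} {[]} = lt

      inside-≡ : length (inside v) ≡ λ′ + λ′
      inside-≡ = begin
        length (inside v) ≡⟨ ≤-antisym (inside≤loops v) (loops≤inside v) ⟩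
        length (loops v) ≡⟨ filter-complement (canonical? v) (loops v) ⟨
        length (canonicals v) + length (noncanonicals v) ≡⟨ cong (length (canonicals v) +_) (reversal-≡ v) ⟨
        length (canonicals v) + length (canonicals v) ≡⟨ cong₂ _+_ canonicals-≡ canonicals-≡ ⟩
        λ′ + λ′ ∎
        where open ≡-Reasoning

    -- Edges leaving a ball

    outer-walk : ∀ {v z} → Reach (suc s) v z → ¬ Ball v z → ∃ λ a → a ∈ cut v × hd v a ≡ z
    outer-walk {v} r ¬b with Reach⇒NB (suc s) r
    ... | p , nb , refl , len with m≤n⇒m<n∨m≡n len
    ... | inj₁ (s≤s p≤s) = contradiction (reach-mono p≤s (NB⇒Reach p nb)) ¬b
    ... | inj₂ p≡ = p ++ [ v ] , ∈-cut⁺ p nb p≡ ¬b , hd-++ v p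

    -- A walk of length at most s from `v` to `x` stays in the ball, so appending `z` cannot
    -- backtrack. The new length must be s + 1, or `z` would be in the ball too.
    crossing : ∀ {v x z} → Adj G z x → Ball v x → ¬ Ball v z → ∃ λ r → z ∷ x ∷ r ∈ cut v
    crossing {v} {x} {z} a b ¬b with Reach⇒NB s b
    ... | [] , nb , refl , len = contradiction (reach-mono s>0 (inj₂ (v , a , refl))) ¬b
    ... | x ∷ p , nb , refl , len = p ++ [ v ] , ∈-cut⁺ (z ∷ x ∷ p) nb′ len′ ¬b
      where
      off : ∀ p → NB (x ∷ p ++ [ v ]) → length (x ∷ p) ≤ s → Off z (p ++ [ v ])
      off [] nb len = ne λ { refl → ¬b (reach-refl s) }
      off (y ∷ p) (step _ _ nb) len =
        ne λ { refl → ¬b (reach-mono (<⇒≤ len) (NB⇒Reach (y ∷ p) nb)) }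
      nb′ : NB (z ∷ x ∷ p ++ [ v ])
      nb′ = step a (off p nb len) nb
      len′ : suc (length (x ∷ p)) ≡ suc s
      len′ with m≤n⇒m<n∨m≡n len
      ... | inj₁ lt = contradiction (reach-mono lt (NB⇒Reach (z ∷ x ∷ p) nb′)) ¬b
      ... | inj₂ eq = cong suc eq

    -- Going back from the end towards `w`, the walk must leave the ball. The part `p′` up to the
    -- inner end of that edge is kept, because it records the branch `y` to which the edge belongs.
    find-crossing : ∀ {v} p {y w} → NB (p ++ y ∷ w ∷ []) → Ball v (hd y p) → ¬ Ball v w →
      ∃ λ p′ → ∃ λ z → length p′ ≤ length p × NB (p′ ++ y ∷ w ∷ []) ×
        Ball v (hd y p′) × Adj G z (hd y p′) × ¬ Ball v z
    find-crossing [] {w = w} nb@(step a _ _) b ¬b = [] , w , z≤n , nb , b , adj-sym a , ¬b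
    find-crossing {v} (x ∷ p) {y} {w} nb b ¬b with ball? v (hd y p)
    ... | no ¬b′ = x ∷ p , hd y p , ≤-refl , nb , b , adj-sym (NB-first p nb) , ¬b′
    ... | yes b′ = let p′ , z , len , rest = find-crossing p (NB-tail p nb) b′ ¬b in
          p′ , z , ≤-trans len (n≤1+n _) , rest

    -- Consequences of having at most q leaving edges

    module SmallCut (q : ℕ) (regular : Regular (suc q) G) (cut≤q : ∀ v → length (cut v) ≤ q) where

      open Regular q regular

      -- Move the centre from `u` to `v` along a path. Vertices lost in the step from `u` to `y` are
      -- at distance s + 1 from `y`, so they are ends of distinct walks in `cut y`: at most q per
      -- step.
      ball-chain : ∀ t {u v} → Reach t v u → (L : List V) → Unique L →
        (∀ {z} → z ∈ L → Ball u z × ¬ Ball v z) → length L ≤ t * q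
      ball-chain t r [] L! spec = z≤n
      ball-chain zero refl (x ∷ L) L! spec = let b , ¬b = spec (here refl) in contradiction b ¬b
      ball-chain (suc t) (inj₁ refl) (x ∷ L) L! spec = let b , ¬b = spec (here refl) in contradiction b ¬b
      ball-chain (suc t) {u} {v} (inj₂ (y , a , r)) L@(_ ∷ _) L! spec = begin
        length L ≡⟨ filter-complement (ball? y) L ⟨
        length (filter (ball? y) L) + length (filter (¬? ∘ ball? y) L) ≤⟨ +-mono-≤ near far ⟩
        t * q + q ≡⟨ +-comm (t * q) q ⟩
        suc t * q ∎
        where
        open ≤-Reasoning
        near : length (filter (ball? y) L) ≤ t * q
        near = ball-chain t r _ (Unique.filter⁺ (ball? y) L!) λ z∈ →
          let z∈L , b = ∈-filter⁻ (ball? y) {xs = L} z∈ in b , proj₂ (spec z∈L)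
        far : length (filter (¬? ∘ ball? y) L) ≤ q
        far = ≤-trans (pigeonhole (λ z a → hd y a ≡ z) (cut y) (Unique.filter⁺ (¬? ∘ ball? y) L!)
          (λ z∈ → let z∈L , ¬b = ∈-filter⁻ (¬? ∘ ball? y) {xs = L} z∈ in
            outer-walk (reach-extend s a (proj₁ (spec z∈L))) ¬b)
          (λ e e′ → trans (sym e) e′)) (cut≤q y)

      -- Branches at a vertex outside the ball

      module _ (j : ℕ) (s≡1+j : s ≡ suc j) {v w : V} (¬bw : ¬ Ball v w) where

        -- As `j` is s - 1, these walks have length s when the step from `w` to `y` is counted.
        Clean : V → Set
        Clean y = All (λ l → ¬ Ball v (hd v l)) (grow j (y ∷ w ∷ []))

        clean? : ∀ y → Dec (Clean y)
        clean? y = All.all? (λ l → ¬? (ball? v (hd v l))) (grow j (y ∷ w ∷ []))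

        -- If no branch were clean, each of the q + 1 branches would contain the inner end of an
        -- edge leaving the ball, at distance at most s from `w`. `walk-unique` recovers the branch
        -- from that end, so there would be more than q such edges.
        clean-branch : ∃ λ y → Adj G w y × Clean y
        clean-branch with Any.any? clean? (nbrs w)
        ... | yes p = let y , y∈ , c = find p in y , ∈-nbrs⁻ y∈ , c
        ... | no none = contradiction
              (≤-trans (≤-reflexive (sym (length-nbrs-suc w)))
                (≤-trans (pigeonhole R (cut v) (nbrs-unique w) total (λ {_} {_} {a} → inj {a = a})) (cut≤q v))) 1+n≰n
          where
          R : V → List V → Set
          -- The second entry of `a` is the inner end of its crossing edge; the default `w` never
          -- occurs there.
          R y a = ∃ λ p → length p < s × NB (p ++ y ∷ w ∷ []) × hd w (drop 1 a) ≡ hd y p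
          total : ∀ {y} → y ∈ nbrs w → ∃ λ a → a ∈ cut v × R y a
          total {y} y∈ with find (¬All⇒Any¬ (λ l → ¬? (ball? v (hd v l))) _ (λ c → none (lose y∈ c)))
          ... | l , l∈ , ¬¬b with ∈-grow⁻ j (step (adj-sym (∈-nbrs⁻ y∈)) [] [-]) l∈
          ... | nb , p , refl , refl with find-crossing p nb
                  (subst (Ball v) (hd-++ v p) (decidable-stable (ball? v _) ¬¬b)) ¬bw
          ... | p′ , z , len , nb′ , b , a , ¬b with crossing a b ¬b
          ... | r , cut∈ = z ∷ hd y p′ ∷ r , cut∈ , p′ , ≤-trans (s≤s len) (≤-reflexive (sym s≡1+j)) , nb′ , refl
          inj : ∀ {y y′ a} → R y a → R y′ a → y ≡ y′
          inj {y} {y′} (p , len , nb , h) (p′ , len′ , nb′ , h′) = ∷ʳ-injectiveʳ p p′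
            (walk-unique (p ++ [ y ]) (p′ ++ [ y′ ])
              (subst NB (sym (++-assoc p [ y ] [ w ])) nb) (subst NB (sym (++-assoc p′ [ y′ ] [ w ])) nb′)
              (trans (hd-++ w p) (trans (sym h) (trans h′ (sym (hd-++ w p′)))))
              (+-mono-≤ (snoc≤ p len) (≤-trans (snoc≤ p′ len′) (≤-reflexive (sym (+-identityʳ s))))))
            where
            snoc≤ : ∀ {y : V} p → length p < s → length (p ++ [ y ]) ≤ s
            snoc≤ p len = ≤-trans (≤-reflexive (trans (length-++ p) (+-comm (length p) 1))) len

        -- Counting through a clean branch

        module _ {y : V} (wy : Adj G w y) (clean : Clean y) where

          base : List V
          base = y ∷ w ∷ []

          base-NB : NB base
          base-NB = step (adj-sym wy) [] [-]

          out? : Decidable (λ l → ¬ Ball v (hd v l))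
          out? l = ¬? (ball? v (hd v l))

          -- Measured from `y` the lengths are s - 1 and s, so all the ends lie in the ball around
          -- `y`.
          far-walks : List (List V)
          far-walks = grow j base ++ filter out? (grow s base)

          ∈-far-walks⁻ : ∀ {l} → l ∈ far-walks → ¬ Ball v (hd v l) × NB l × ∃ λ p → l ≡ p ++ base × length p ≤ s
          ∈-far-walks⁻ l∈ with ∈-++⁻ (grow j base) l∈
          ... | inj₁ l∈ = let nb , p , eq , len = ∈-grow⁻ j base-NB l∈ in
                All.lookup clean l∈ , nb , p , eq , ≤-trans (≤-reflexive len) (≤-trans (n≤1+n j) (≤-reflexive (sym s≡1+j)))
          ... | inj₂ l∈ with ∈-filter⁻ out? {xs = grow s base} l∈
          ... | l∈grow , ¬b = let nb , p , eq , len = ∈-grow⁻ s base-NB l∈grow in ¬b , nb , p , eq , ≤-reflexive len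

          far-walks-unique : Unique far-walks
          far-walks-unique = Unique.++⁺ (grow-unique j base) (Unique.filter⁺ out? (grow-unique s base)) λ (p , q) →
            let _ , a , eq , len = ∈-grow⁻ j base-NB p
                _ , b , eq′ , len′ = ∈-grow⁻ s base-NB (proj₁ (∈-filter⁻ out? {xs = grow s base} q))
            in <⇒≢ (n<1+n j) (trans (sym len) (trans (cong length (++-cancelʳ base a b (trans (sym eq) eq′))) (trans len′ s≡1+j)))

          -- The walks are compared from `y`, not `w`: only then do the two lengths add up to at
          -- most 2s.
          end-injective : ∀ p p′ → NB (p ++ base) → NB (p′ ++ base) → length p ≤ s → length p′ ≤ s →
            hd v (p ++ base) ≡ hd v (p′ ++ base) → p ++ base ≡ p′ ++ base
          end-injective p p′ nb nb′ len len′ h = cong (_++ base)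
            (walk-unique p p′ (NB-prefix′ p nb) (NB-prefix′ p′ nb′) (trans (sym (hd-++ v p)) (trans h (hd-++ v p′)))
              (+-mono-≤ len (≤-trans len′ (≤-reflexive (sym (+-identityʳ s))))))

          far : List V
          far = w ∷ map (hd v) far-walks

          far-unique : Unique far
          far-unique = ¬Any⇒All¬ _ w∉ ∷ map-unique (hd v) far-walks-unique inj
            where
            inj : ∀ {l l′} → l ∈ far-walks → l′ ∈ far-walks → hd v l ≡ hd v l′ → l ≡ l′
            inj l∈ l∈′ h with ∈-far-walks⁻ l∈ | ∈-far-walks⁻ l∈′
            ... | _ , nb , p , refl , len | _ , nb′ , p′ , refl , len′ = end-injective p p′ nb nb′ len len′ h
            -- The step from `y` to `w` is the only walk of length at most s from `y` to `w`, and
            -- after the step from `w` to `y` it would backtrack.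
            w∉ : w ∉ map (hd v) far-walks
            w∉ w∈ with ∈-map⁻ (hd v) w∈
            ... | l , l∈ , h with ∈-far-walks⁻ l∈
            ... | _ , nb , p , refl , len with walk-unique p [ w ] (NB-prefix′ p nb) (step wy [] [-])
                    (trans (sym (hd-++ v p)) (sym h)) (+-mono-≤ len (≤-trans s>0 (≤-reflexive (sym (+-identityʳ s)))))
            ... | refl with nb
            ... | step _ (ne w≢w) _ = w≢w refl

          far-spec : ∀ {z} → z ∈ far → Ball y z × ¬ Ball v z
          far-spec (here refl) = reach-mono s>0 (inj₂ (y , wy , refl)) , ¬bw
          far-spec (there z∈) with ∈-map⁻ (hd v) z∈
          ... | l , l∈ , refl with ∈-far-walks⁻ l∈
          ... | ¬b , nb , p , refl , len =
                subst (Ball y) (sym (hd-++ v p)) (reach-mono len (NB⇒Reach p (NB-prefix′ p nb))) , ¬b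

          -- The vertex before the end is outside the ball because the branch is clean, so the last
          -- step enters the ball across one of its leaving edges. The inner end of that edge
          -- determines the walk.
          few-return : length (filter (λ l → ball? v (hd v l)) (grow s base)) ≤ q
          few-return = ≤-trans (pigeonhole R (cut v) (Unique.filter⁺ _ (grow-unique s base)) total (λ {_} {_} {a} → inj {a = a})) (cut≤q v)
            where
            R : List V → List V → Set
            R l a = l ∈ grow s base × hd w (drop 1 a) ≡ hd v l
            total : ∀ {l} → l ∈ filter (λ l → ball? v (hd v l)) (grow s base) → ∃ λ a → a ∈ cut v × R l a
            total l∈ with ∈-filter⁻ (λ l → ball? v (hd v l)) {xs = grow s base} l∈
            ... | l∈grow , b with ∈-grow⁻ s base-NB l∈grow
            ... | nb , [] , refl , len = contradiction (trans len s≡1+j) λ ()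
            ... | nb , x ∷ p , refl , len with crossing (adj-sym (NB-first p nb)) b (subst (¬_ ∘ Ball v) (hd-++ v p) (All.lookup clean
                    (subst (λ k → p ++ base ∈ grow k base) (suc-injective (trans len s≡1+j)) (∈-grow⁺ p (NB-tail p nb)))))
            ... | r , cut∈ = hd y p ∷ x ∷ r , cut∈ , l∈grow , refl
            inj : ∀ {l l′ a} → R l a → R l′ a → l ≡ l′
            inj (l∈ , h) (l∈′ , h′) with ∈-grow⁻ s base-NB l∈ | ∈-grow⁻ s base-NB l∈′
            ... | nb , p , refl , len | nb′ , p′ , refl , len′ =
                  end-injective p p′ nb nb′ (≤-reflexive len) (≤-reflexive len′) (trans (sym h) h′)

          -- The lone `q` pays for the walks that return to the ball. The rest is `ball-chain` over
          -- the s + 2 steps from `v` through `w` to `y`; the `suc` on the left counts `w`.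
          far-bound : Reach (suc s) v w → suc (q ^ j + q ^ s) ≤ q + suc (suc s) * q
          far-bound r = begin
            suc (q ^ j + q ^ s) ≡⟨ cong suc (cong₂ _+_ (length-grow j base-NB) (length-grow s base-NB)) ⟨
            suc (lj + length (grow s base)) ≡⟨ cong (λ k → suc (lj + k)) (filter-complement (λ l → ball? v (hd v l)) (grow s base)) ⟨
            suc (lj + (ret + out)) ≡⟨ cong suc (trans (sym (+-assoc lj ret out)) (trans (cong (_+ out) (+-comm lj ret)) (+-assoc ret lj out))) ⟩
            suc (ret + (lj + out)) ≡⟨ cong (λ k → suc (ret + k)) (trans (length-map (hd v) far-walks) (length-++ (grow j base))) ⟨
            suc (ret + length (map (hd v) far-walks)) ≡⟨ +-suc ret _ ⟨
            ret + length far ≤⟨ +-mono-≤ few-return (ball-chain (suc (suc s)) (inj₂ (w , adj-sym wy , r)) far far-unique far-spec) ⟩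
            q + suc (suc s) * q ∎
            where
            open ≤-Reasoning
            lj ret out : ℕ
            lj = length (grow j base)
            ret = length (filter (λ l → ball? v (hd v l)) (grow s base))
            out = length (filter out? (grow s base))

-- Growth of powers and the arithmetic of `nc`

power-bound : ∀ q t → 2 ≤ q → 6 + t ≤ q ^ (1 + t) + q ^ (2 + t)
power-bound q t 2≤q = ≤-trans (two t) (+-mono-≤ (^-monoˡ-≤ (1 + t) 2≤q) (^-monoˡ-≤ (2 + t) 2≤q))
  where
  two : ∀ t → 6 + t ≤ 2 ^ (1 + t) + 2 ^ (2 + t)
  two zero = ≤-refl
  two (suc t) = begin
    6 + suc t ≡⟨ +-suc 6 t ⟩
    1 + (6 + t) ≤⟨ +-monoˡ-≤ (6 + t) {1} {6 + t} (s≤s z≤n) ⟩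
    6 + t + (6 + t) ≡⟨ cong (6 + t +_) (+-identityʳ (6 + t)) ⟨
    2 * (6 + t) ≤⟨ *-monoʳ-≤ 2 (two t) ⟩
    2 * (2 ^ (1 + t) + 2 ^ (2 + t)) ≡⟨ *-distribˡ-+ 2 (2 ^ (1 + t)) (2 ^ (2 + t)) ⟩
    2 ^ (2 + t) + 2 ^ (3 + t) ∎
    where open ≤-Reasoning

-- This contradicts `far-bound` with s = 3 + t. For q = 2 and t = 0 both sides are 12 apart from the
-- `suc`, so the vertex `w` is what makes the inequality strict.
growth : ∀ q t → 2 ≤ q → q + (5 + t) * q < suc (q ^ (2 + t) + q ^ (3 + t))
growth q t 2≤q = s≤s (begin
  (6 + t) * q ≤⟨ *-monoˡ-≤ q (power-bound q t 2≤q) ⟩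
  (q ^ (1 + t) + q ^ (2 + t)) * q ≡⟨ *-comm _ q ⟩
  q * (q ^ (1 + t) + q ^ (2 + t)) ≡⟨ *-distribˡ-+ q (q ^ (1 + t)) (q ^ (2 + t)) ⟩
  q ^ (2 + t) + q ^ (3 + t) ∎)
  where open ≤-Reasoning

2∣suc[n]*n : ∀ n → 2 ∣ suc n * n
2∣suc[n]*n zero = divides 0 refl
2∣suc[n]*n (suc n) = subst (2 ∣_) (sym (*-distribʳ-+ (suc n) 2 n))
  (∣m∣n⇒∣m+n (m∣m*n (suc n)) (subst (2 ∣_) (*-comm (suc n) n) (2∣suc[n]*n n)))

-- The halving in `nc` is exact: for s > 0 the product contains the consecutive factors q and q + 1.
nc-double : ∀ q s → 0 < s → nc (suc q) s * 2 ≡ suc q * q ^ s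
nc-double q (suc s) _ = m/n*n≡m
  (subst (2 ∣_) (*-assoc (suc q) q (q ^ s)) (∣m⇒∣m*n (q ^ s) (2∣suc[n]*n q)))

-- Here `i` and `c` are the numbers of closing and leaving walks and `a` is `nc`; `ε ≤ a` makes the
-- truncated subtraction a true one.
cut-arithmetic : ∀ {i c} a ε → ε ≤ a → i ≡ (a ∸ ε) + (a ∸ ε) → i + c ≡ a * 2 → c ≡ 2 * ε
cut-arithmetic {c = c} a ε ε≤a refl eq = +-cancelˡ-≡ (d + d) c (2 * ε) (begin
  d + d + c ≡⟨ eq ⟩
  a * 2 ≡⟨ cong (_* 2) (m∸n+n≡m ε≤a) ⟨
  (d + ε) * 2 ≡⟨ identity d ε ⟩
  d + d + 2 * ε ∎)
  where
  open ≡-Reasoning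
  d = a ∸ ε
  identity : ∀ d ε → (d + ε) * 2 ≡ d + d + 2 * ε
  identity = solve-∀

-- Small cuts are empty; the contradiction

no-small-cut : ∀ {n} (G : Graph n) q s t → s ≡ 3 + t → 2 ≤ q → Regular (suc q) G →
  (no-short : ∀ m → m < 2 * s + 1 → ¬ HasCycleOfLength G m) (s>0 : 0 < s) →
  let open Walks.Girth G s s>0 no-short in
  (∀ v → length (cut v) ≤ q) → ∀ v → length (cut v) ≡ 0
no-small-cut G q s t s≡ 2≤q regular no-short s>0 cut≤q v = n≤0⇒n≡0 (≮⇒≥ nonempty⇒⊥)
  where
  open Walks G
  open Girth s s>0 no-short
  open SmallCut q regular cut≤q

  nonempty⇒⊥ : ¬ 0 < length (cut v)
  nonempty⇒⊥ 0< with pick (cut v) 0<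
    where
    pick : ∀ (ls : List (List V)) → 0 < length ls → ∃ (_∈ ls)
    pick (l ∷ _) _ = l , here refl
  ... | l , l∈cut with ∈-filter⁻ (λ l → ¬? (ball? v (hd v l))) {xs = grow (suc s) [ v ]} l∈cut
  -- The end of a leaving walk serves as `w`: outside the ball, yet within s + 1 of `v` by the
  -- length of the walk.
  ... | l∈ , ¬b with ∈-grow⁻ (suc s) [-] l∈
  ... | nb , p , refl , len with subst (¬_ ∘ Ball v) (hd-++ v p) ¬b
  ... | ¬bw with clean-branch (2 + t) s≡ ¬bw
  ... | y , wy , clean = <⇒≱ (growth q t 2≤q)
        (subst (λ s → suc (q ^ (2 + t) + q ^ s) ≤ q + suc (suc s) * q) s≡
          (far-bound (2 + t) s≡ ¬bw wy clean (subst (λ m → Reach m v (hd v p)) len (NB⇒Reach p nb))))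

theorem10 : (k s ε : ℕ) → 3 ≤ k → 7 ≤ 2 * s + 1 → 0 < ε → 2 * ε ≤ k ∸ 1 →
    (n : ℕ) → ¬ Σ (Graph n) (VGR n k (2 * s + 1) (nc k s ∸ ε))
theorem10 (suc q) s ε (s≤s 2≤q) 7≤g ε>0 2ε≤q n (G , regular , ((c , _) , no-short) , cycles) =
  -- The cut at `v` has 2ε > 0 elements and is empty by `no-small-cut`.
  <⇒≢ (≤-trans ε>0 (m≤m+n ε (ε + 0)))
    (trans (sym (no-small-cut G q s (s ∸ 3) (sym (m+[n∸m]≡n 3≤s)) 2≤q regular no-short s>0 cut≤q v)) (length-cut v))
  where
  3≤s : 3 ≤ s
  3≤s = *-cancelˡ-≤ 2 (+-cancelʳ-≤ 1 6 (2 * s) 7≤g)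

  s>0 : 0 < s
  s>0 = ≤-trans (s≤s z≤n) 3≤s

  open Walks G
  open Girth s s>0 no-short
  open Regular q regular

  2ε≤2nc : 2 * ε ≤ 2 * nc (suc q) s
  2ε≤2nc = begin
    2 * ε ≤⟨ 2ε≤q ⟩
    q ≤⟨ n≤1+n q ⟩
    suc q ≡⟨ *-identityʳ (suc q) ⟨
    suc q * 1 ≤⟨ *-monoʳ-≤ (suc q) (m^n>0 q {{>-nonZero (≤-trans (s≤s z≤n) 2≤q)}} s) ⟩
    suc q * q ^ s ≡⟨ nc-double q s s>0 ⟨
    nc (suc q) s * 2 ≡⟨ *-comm (nc (suc q) s) 2 ⟩
    2 * nc (suc q) s ∎
    where open ≤-Reasoning

  length-cut : ∀ v → length (cut v) ≡ 2 * ε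
  length-cut v = cut-arithmetic (nc (suc q) s) ε (*-cancelˡ-≤ 2 2ε≤2nc) (inside-≡ (cycles v))
    (trans (filter-complement (λ l → ball? v (hd v l)) (grow (suc s) [ v ]))
      (trans (length-grow-single s v) (sym (nc-double q s s>0))))

  cut≤q : ∀ v → length (cut v) ≤ q
  cut≤q v = ≤-trans (≤-reflexive (length-cut v)) 2ε≤q

  -- The cycle that witnesses the girth supplies a vertex.
  v : V
  v = lookup c (fromℕ< (m≤n+m 1 (2 * s)))
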